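{- Let $p\ge1$ and $\ell\ge1$. There is a constant $\alpha$, depending only on $p$ and $\ell$, such that, considering item access level interleaving, for any two merges $M_1$ and $M_2$ of the same $p$ sequences of requests to a list of $\ell$ items, and any scheduling of steps to DMTF (serving $M_1$) and OPT (serving $M_2$), $$\mathrm{DMTF}(M_1)\le(4p^2-2p)\,\mathrm{OPT}(M_2)+\alpha.$$
   Context: List Accessing: a list of $\ell$ distinct items is maintained in some order, starting from a fixed initial order. A request is an item of the list. A sequential algorithm serves a request by searching from the front of the list; the cost is the index (position, starting at $1$) of the item. After the access, the item may be moved, free of charge, to any location closer to the front. (Paid exchanges, which switch two adjacent items at cost $1$, are also allowed.) For a request sequence $M$, $\mathrm{OPT}(M)$ denotes the minimum total cost of an offline sequential algorithm (knowing all of $M$) serving the requests of $M$ in order. There are $p$ processes $p_1,\dots,p_p$, each with its own finite request sequence $\sigma_1,\dots,\sigma_p$. A merge of the sequences is an interleaving of all their requests that respects the order of each sequence. Both DMTF and OPT start from the same initial list. DMTF is the distributed Move-to-Front algorithm: each item found is moved to the front of the list. Item access level interleaving: several processes may be searching for the same item at the same time. All requests to an item $a$ that are concurrent in this sense (one process finds $a$ and moves it to the front, and the others started their search for $a$ before this move and finish it after the move) are assumed to find $a$ in the same location and to have the same cost; they are linearized as successive requests to $a$. Thus an execution of DMTF serving $M_1$ is given by a division of $M_1$ into consecutive groups, each group consisting of requests to one and the same item made by distinct processes; if the item is at position $i$ of the list when the group is served, each request of the group has cost $i$, and then the item is moved to the front of the list. $\mathrm{DMTF}(M_1)$ is the total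 cost of all requests; the choice of groups (the scheduling) is arbitrary. Only the costs of searching through the list are counted. -}

module Defs where

open import Data.Empty using (⊥)
open import Data.Fin using (Fin; _≟_)
open import Data.List using (List; []; _∷_; _++_; length; map; filter; allFin)
open import Data.List.Membership.Propositional using (_∈_)
open import Data.List.Membership.Propositional.Properties using (∈-∃++; ∈-allFin)
open import Data.List.Relation.Binary.Permutation.Propositional
  using (_↭_; ↭-sym)
open import Data.List.Relation.Binary.Permutation.Propositional.Properties
  using (∈-resp-↭)
open import Data.List.Relation.Unary.Unique.Propositional using (Unique)
open import Data.Nat using (ℕ; zero; suc; _+_; _*_; _∸_; _≤_; _<_; z≤n; s≤s; _≤?_)
open import Data.Nat.Induction using (<-wellFounded)
open import Data.Nat.Properties
  using (≤-refl; ≤-reflexive; ≤-trans; m∸n≤m; m+n≤o⇒m≤o; +-monoʳ-≤; m+[n∸m]≡n; m+n≤o⇒m≤o∸n; +-comm)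
open import Data.Product using (∃-syntax; _×_; _,_; proj₁; proj₂)
open import Data.Sum using (_⊎_; inj₁; inj₂)
open import Induction.WellFounded using (Acc; acc)
open import Relation.Binary.PropositionalEquality using (_≡_; refl)
open import Relation.Nullary using (Dec; yes; no)
open import Relation.Nullary.Decidable using (map′; _×-dec_; _⊎-dec_)

Item : ℕ → Set
Item ℓ = Fin ℓ

-- The items are named by Fin ℓ; an order of the list contains each of them
-- exactly once.
record ListOrder (ℓ : ℕ) : Set where
  field
    items    : List (Item ℓ)
    arranges : items ↭ allFin ℓ

open ListOrder public

-- A request in a merge remembers the process that issues it.
Request : ℕ → ℕ → Set
Request p ℓ = Fin p × Item ℓ

process : ∀ {p ℓ} → Request p ℓ → Fin p
process = proj₁

item : ∀ {p ℓ} → Request p ℓ → Item ℓ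
item = proj₂

IsMerge : ∀ {p ℓ} → (Fin p → List (Item ℓ)) → List (Request p ℓ) → Set
IsMerge σ M = ∀ i → map item (filter (λ r → process r ≟ i) M) ≡ σ i

module _ {p ℓ : ℕ} where

  -- An execution serves the merge group by group.  A group is a nonempty list
  -- i ∷ is of distinct processes requesting the same item a.
  data DMTFExecution : List (Item ℓ) → List (Request p ℓ) → Set where
    []    : ∀ {L} → DMTFExecution L []
    serve : ∀ xs a ys i is {M} → Unique (i ∷ is) →
            DMTFExecution (a ∷ xs ++ ys) M →
            DMTFExecution (xs ++ a ∷ ys) (map (_, a) (i ∷ is) ++ M)

  costDMTF : ∀ {L M} → DMTFExecution L M → ℕ
  costDMTF []                       = 0
  costDMTF (serve xs a ys i is _ E) =
    length (i ∷ is) * suc (length xs) + costDMTF E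

module _ {ℓ : ℕ} where

  -- What an offline sequential algorithm does on a request sequence.  In
  -- `access`, the item a found behind xs ++ ys is moved for free in front of
  -- ys; it stays where it is when ys is empty.
  data Schedule : List (Item ℓ) → List (Item ℓ) → Set where
    []       : ∀ {L} → Schedule L []
    exchange : ∀ xs a b ys {M} →
               Schedule (xs ++ b ∷ a ∷ ys) M →
               Schedule (xs ++ a ∷ b ∷ ys) M
    access   : ∀ xs ys a zs {M} →
               Schedule (xs ++ a ∷ ys ++ zs) M →
               Schedule (xs ++ ys ++ a ∷ zs) (a ∷ M)

  cost : ∀ {L M} → Schedule L M → ℕ
  cost []                     = 0
  cost (exchange xs a b ys S) = suc (cost S)
  cost (access xs ys a zs S)  = suc (length (xs ++ ys)) + cost S

  IsOptimal : ∀ {L M} → Schedule L M → Set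
  IsOptimal {L} {M} S = (S′ : Schedule L M) → cost S ≤ cost S′

  -- An optimal schedule exists: the schedule that never reorders the list
  -- bounds the minimum, and for every n it is decidable whether some schedule
  -- has cost at most n.

  private

    someSchedule : ∀ {L} → L ↭ allFin ℓ → ∀ M → Schedule L M
    someSchedule π []      = []
    someSchedule π (a ∷ M) with ∈-∃++ (∈-resp-↭ (↭-sym π) (∈-allFin a))
    ... | xs , zs , refl = access xs [] a zs (someSchedule π M)

    Within : ℕ → List (Item ℓ) → List (Item ℓ) → Set
    Within n L M = ∃[ S ] cost {L} {M} S ≤ n

    Split : List (Item ℓ) → (List (Item ℓ) → List (Item ℓ) → Set) → Set
    Split L P = ∃[ xs ] ∃[ ys ] xs ++ ys ≡ L × P xs ys

    split? : ∀ L {P} → (∀ xs ys → Dec (P xs ys)) → Dec (Split L P)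
    split? [] {P} P? = map′ to from (P? [] [])
      where
      to : P [] [] → Split [] P
      to q = [] , [] , refl , q
      from : Split [] P → P [] []
      from ([] , [] , refl , q) = q
    split? (x ∷ L) {P} P? =
      map′ to from (P? [] (x ∷ L) ⊎-dec split? L (λ xs → P? (x ∷ xs)))
      where
      to : P [] (x ∷ L) ⊎ Split L (λ xs → P (x ∷ xs)) → Split (x ∷ L) P
      to (inj₁ q)                    = [] , x ∷ L , refl , q
      to (inj₂ (xs , ys , refl , q)) = x ∷ xs , ys , refl , q
      from : Split (x ∷ L) P → P [] (x ∷ L) ⊎ Split L (λ xs → P (x ∷ xs))
      from ([] , _ , refl , q)      = inj₁ q
      from (_ ∷ xs , ys , refl , q) = inj₂ (xs , ys , refl , q)

    ExchangeAt : ℕ → List (Item ℓ) → (xs ys : List (Item ℓ)) → Set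
    ExchangeAt n M xs (a ∷ b ∷ ys) = Within n (xs ++ b ∷ a ∷ ys) M
    ExchangeAt n M xs _            = ⊥

    AccessAt : ℕ → Item ℓ → List (Item ℓ) → (xs ys zs : List (Item ℓ)) → Set
    AccessAt n a M xs ys []       = ⊥
    AccessAt n a M xs ys (b ∷ zs) =
      b ≡ a × length (xs ++ ys) ≤ n ×
      Within (n ∸ length (xs ++ ys)) (xs ++ a ∷ ys ++ zs) M

    FirstStep : ℕ → List (Item ℓ) → Item ℓ → List (Item ℓ) → Set
    FirstStep n L a M =
      Split L (ExchangeAt n (a ∷ M)) ⊎
      Split L (λ xs rest → Split rest (AccessAt n a M xs))

    first⇒within : ∀ {n L a M} → FirstStep n L a M → Within (suc n) L (a ∷ M)
    first⇒within (inj₁ (xs , a ∷ b ∷ ys , refl , S , le)) =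
      exchange xs a b ys S , s≤s le
    first⇒within (inj₂ (xs , _ , refl , ys , a ∷ zs , refl , refl , k≤n , S , le)) =
      access xs ys a zs S ,
      s≤s (≤-trans (+-monoʳ-≤ (length (xs ++ ys)) le) (≤-reflexive (m+[n∸m]≡n k≤n)))

    within⇒first : ∀ {n L a M} → Within (suc n) L (a ∷ M) → FirstStep n L a M
    within⇒first (exchange xs a b ys S , s≤s le) =
      inj₁ (xs , a ∷ b ∷ ys , refl , S , le)
    within⇒first (access xs ys a zs S , s≤s le) =
      inj₂ (xs , _ , refl , ys , a ∷ zs , refl , refl ,
            m+n≤o⇒m≤o (length (xs ++ ys)) le , S ,
            m+n≤o⇒m≤o∸n (cost S)
              (≤-trans (≤-reflexive (+-comm (cost S) (length (xs ++ ys)))) le))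

    within? : ∀ n → Acc _<_ n → ∀ L M → Dec (Within n L M)
    within? n       _        L []      = yes ([] , z≤n)
    within? zero    _        L (a ∷ M) =
      no λ { (exchange _ _ _ _ _ , ()) ; (access _ _ _ _ _ , ()) }
    within? (suc n) (acc rs) L (a ∷ M) =
      map′ first⇒within within⇒first
        (split? L exchangeAt? ⊎-dec split? L (λ xs rest → split? rest (accessAt? xs)))
      where
      exchangeAt? : ∀ xs ys → Dec (ExchangeAt n (a ∷ M) xs ys)
      exchangeAt? xs []           = no λ ()
      exchangeAt? xs (_ ∷ [])     = no λ ()
      exchangeAt? xs (b ∷ c ∷ ys) = within? n (rs ≤-refl) _ _

      accessAt? : ∀ xs ys zs → Dec (AccessAt n a M xs ys zs)
      accessAt? xs ys []       = no λ ()
      accessAt? xs ys (b ∷ zs) =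
        (b ≟ a) ×-dec (length (xs ++ ys) ≤? n) ×-dec
        within? (n ∸ length (xs ++ ys)) (rs (s≤s (m∸n≤m n (length (xs ++ ys))))) _ _

    least : {P : ℕ → Set} → (∀ n → Dec (P n)) → ∀ n → P n →
            ∃[ m ] P m × (∀ k → P k → m ≤ k)
    least P? n pn with P? 0
    least P? n       pn | yes p0 = 0 , p0 , λ _ _ → z≤n
    least P? zero    pn | no ¬p0 = 0 , pn , λ _ _ → z≤n
    least {P} P? (suc n) pn | no ¬p0 with least (λ k → P? (suc k)) n pn
    ... | m , pm , min = suc m , pm , bound
      where
      bound : ∀ k → P k → suc m ≤ k
      bound zero    pk with () ← ¬p0 pk
      bound (suc k) pk = s≤s (min k pk)

  optimalSchedule : (L : ListOrder ℓ) (M : List (Item ℓ)) →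
                    ∃[ S ] IsOptimal {items L} {M} S
  optimalSchedule L M
    with S₀ ← someSchedule (arranges L) M
    with least (λ n → within? n (<-wellFounded n) (items L) M) (cost S₀) (S₀ , ≤-refl)
  ... | m , (S , le) , min = S , λ S′ → ≤-trans le (min (cost S′) (S′ , ≤-refl))

  OPT : ListOrder ℓ → List (Item ℓ) → ℕ
  OPT L M = cost (proj₁ (optimalSchedule L M))

module Submission where

open import Defs
open import Data.Bool using (Bool; true; false; T)
open import Data.Fin using (Fin; _≟_)
open import Data.List using (List; []; _∷_; _++_; length; map; filter; allFin; cartesianProduct)
open import Data.List.Membership.Propositional using (_∈_)
open import Data.List.Membership.Propositional.Properties
  using (∈-allFin; ∈-cartesianProduct⁺)
open import Data.List.Properties using (++-assoc; length-++; length-tabulate)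
open import Data.List.Relation.Binary.Permutation.Propositional
  using (_↭_; ↭-sym; ↭-trans; ↭⇒↭ₛ)
open import Data.List.Relation.Binary.Permutation.Propositional.Properties
  using (∈-resp-↭)
  renaming (map⁺ to ↭-map⁺; shift to ↭-shift; ++⁺ˡ to ↭-++⁺ˡ)
open import Data.List.Relation.Binary.Permutation.Setoid.Properties using (Unique-resp-↭)
open import Data.List.Relation.Unary.All as All using (All; []; _∷_)
open import Data.List.Relation.Unary.All.Properties
  using () renaming (++⁺ to All-++⁺; ++⁻ˡ to All-++⁻ˡ; ++⁻ʳ to All-++⁻ʳ)
open import Data.List.Relation.Unary.AllPairs using (AllPairs; []; _∷_)
open import Data.List.Relation.Unary.Any using (here; there)
open import Data.List.Relation.Unary.Unique.Propositional using (Unique)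
open import Data.List.Relation.Unary.Unique.Propositional.Properties
  using (allFin⁺; cartesianProduct⁺)
open import Data.Nat
  using (ℕ; zero; suc; _+_; _*_; _∸_; _^_; _≤_; _<_; _≥_; z≤n; s≤s; s≤s⁻¹; _≤?_; _<?_)
import Data.Nat as ℕ
open import Data.Nat.ListAction using (sum)
open import Data.Nat.ListAction.Properties using (sum-↭)
open import Data.Nat.Properties hiding (_≟_; _≤?_; _<?_)
open import Data.Nat.Tactic.RingSolver using (solve-∀)
open import Data.Product using (∃-syntax; _×_; _,_; proj₁; proj₂)
open import Data.Product.Properties using (≡-dec)
open import Data.Sum using (_⊎_; inj₁; inj₂)
open import Data.Unit using (⊤; tt)
open import Function using (_∘_)
open import Relation.Binary.Definitions using (DecidableEquality; tri<; tri≈; tri>)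
open import Relation.Binary.PropositionalEquality
  using (_≡_; _≢_; refl; sym; trans; cong; cong₂; subst; setoid)
open import Relation.Nullary using (Dec; yes; no; ¬_; contradiction)
open import Relation.Nullary.Decidable using (T?; _×-dec_; ¬?)

open ≤-Reasoning

-- Let every process i run Move-to-Front on σ i alone, and let C be the total
-- cost of these p runs.  The constant α is 0.
--
-- C ≤ 2p · OPT(M₂): the inversions between the list of process i and the list
-- of a schedule of M₂ show MTF(σ i) ≤ 2 · OPT(M₂), since a free move made for
-- another process creates fewer inversions than that access costs.
--
-- DMTF(M₁) ≤ (2p − 1) · C: merge the p lists into one list of p · ℓ copies of
-- items, ordered by last access.  A request of process i to a, at rank k
-- (from 0) in its own list, costs at most 1 plus the number of copies in front
-- of (i, a).  At most k of these are of process i.  The potential is the number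
-- of pairs of copies that the merged order and the ranks in the separate lists
-- order in opposite ways.  For each other process, a copy in front of (i, a)
-- with a rank above k leaves such a pair, at most k + 1 have rank at most k,
-- and at most k new pairs arise, so the amortized cost is at most
-- 1 + k + (p − 1)(2k + 1) ≤ (2p − 1)(k + 1).

private variable
  A B P Q R : Set

-- Finite sums

∑ : List A → (A → ℕ) → ℕ
∑ xs f = sum (map f xs)

∑-mono : ∀ (xs : List A) {f g} → (∀ x → f x ≤ g x) → ∑ xs f ≤ ∑ xs g
∑-mono []       f≤g = z≤n
∑-mono (x ∷ xs) f≤g = +-mono-≤ (f≤g x) (∑-mono xs f≤g)

∑-monoAll : ∀ {xs : List A} {f g} → All (λ x → f x ≤ g x) xs → ∑ xs f ≤ ∑ xs g
∑-monoAll []        = z≤n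
∑-monoAll (px ∷ ps) = +-mono-≤ px (∑-monoAll ps)

-- One occurrence of `e` carries the extra terms `c` and `d`; the other entries are compared
-- pointwise. The amortized arguments use it for the one summand that a request treats specially.
∑-mono-at : ∀ {e : A} {xs f g} c d → e ∈ xs → (∀ x → f x ≤ g x) →
            f e + c ≤ g e + d → ∑ xs f + c ≤ ∑ xs g + d
∑-mono-at {xs = x ∷ xs} {f} {g} c d (here refl) f≤g le = begin
  f x + ∑ xs f + c   ≡⟨ swapʳ (f x) (∑ xs f) c ⟩
  f x + c + ∑ xs f   ≤⟨ +-mono-≤ le (∑-mono xs f≤g) ⟩
  g x + d + ∑ xs g   ≡⟨ swapʳ (g x) d (∑ xs g) ⟩
  g x + ∑ xs g + d   ∎
  where
  swapʳ : ∀ a b c → a + b + c ≡ a + c + b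
  swapʳ = solve-∀
∑-mono-at {xs = x ∷ xs} {f} {g} c d (there e∈) f≤g le = begin
  f x + ∑ xs f + c   ≡⟨ +-assoc (f x) _ c ⟩
  f x + (∑ xs f + c) ≤⟨ +-mono-≤ (f≤g x) (∑-mono-at c d e∈ f≤g le) ⟩
  g x + (∑ xs g + d) ≡⟨ +-assoc (g x) _ d ⟨
  g x + ∑ xs g + d   ∎

∑-const : ∀ (xs : List A) c → ∑ xs (λ _ → c) ≡ length xs * c
∑-const []       c = refl
∑-const (_ ∷ xs) c = cong (c +_) (∑-const xs c)

∑-zero : ∀ (xs : List A) {f} → (∀ x → f x ≤ 0) → ∑ xs f ≤ 0
∑-zero []       f≤0 = z≤n
∑-zero (x ∷ xs) f≤0 = +-mono-≤ (f≤0 x) (∑-zero xs f≤0)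

∑-+ : ∀ (xs : List A) (f g : A → ℕ) → ∑ xs (λ x → f x + g x) ≡ ∑ xs f + ∑ xs g
∑-+ []       f g = refl
∑-+ (x ∷ xs) f g = trans (cong (f x + g x +_) (∑-+ xs f g)) (exch (f x) (g x) _ _)
  where
  exch : ∀ a b c d → a + b + (c + d) ≡ (a + c) + (b + d)
  exch = solve-∀

∑-++ : ∀ (xs ys : List A) f → ∑ (xs ++ ys) f ≡ ∑ xs f + ∑ ys f
∑-++ []       ys f = refl
∑-++ (x ∷ xs) ys f = trans (cong (f x +_) (∑-++ xs ys f)) (sym (+-assoc (f x) _ _))

∑-swap : ∀ (xs : List A) (ys : List B) (f : A → B → ℕ) →
         ∑ xs (λ x → ∑ ys (f x)) ≡ ∑ ys (λ y → ∑ xs (λ x → f x y))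
∑-swap xs []       f = trans (∑-const xs 0) (*-zeroʳ (length xs))
∑-swap xs (y ∷ ys) f = trans (∑-+ xs (λ x → f x y) _) (cong (_ +_) (∑-swap xs ys f))

∑-product : ∀ (xs : List A) (ys : List B) (f : A × B → ℕ) →
            ∑ (cartesianProduct xs ys) f ≡ ∑ xs (λ x → ∑ ys (λ y → f (x , y)))
∑-product []       ys f = refl
∑-product (x ∷ xs) ys f =
  trans (∑-++ (map (x ,_) ys) _ f) (cong₂ _+_ (row ys) (∑-product xs ys f))
  where
  row : ∀ ys → ∑ (map (x ,_) ys) f ≡ ∑ ys (λ y → f (x , y))
  row []       = refl
  row (y ∷ ys) = cong (f (x , y) +_) (row ys)

∑-↭ : ∀ {xs ys : List A} f → xs ↭ ys → ∑ xs f ≡ ∑ ys f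
∑-↭ f p = sum-↭ (↭-map⁺ f p)

∈⇒≤∑ : ∀ {x : A} {xs} f → x ∈ xs → f x ≤ ∑ xs f
∈⇒≤∑ f (here refl) = m≤m+n (f _) _
∈⇒≤∑ f (there x∈)  = ≤-trans (∈⇒≤∑ f x∈) (m≤n+m _ (f _))

-- Counting

𝟙 : Dec P → ℕ
𝟙 (yes _) = 1
𝟙 (no _)  = 0

𝟙-mono : (d : Dec P) (e : Dec Q) → (P → Q) → 𝟙 d ≤ 𝟙 e
𝟙-mono (yes p) (yes _) _ = ≤-refl
𝟙-mono (yes p) (no ¬q) f = contradiction (f p) ¬q
𝟙-mono (no _)  _       _ = z≤n

𝟙-≤1 : (d : Dec P) → 𝟙 d ≤ 1
𝟙-≤1 (yes _) = ≤-refl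
𝟙-≤1 (no _)  = z≤n

𝟙-yes : (d : Dec P) → P → 1 ≤ 𝟙 d
𝟙-yes (yes _) _ = ≤-refl
𝟙-yes (no ¬p) p = contradiction p ¬p

𝟙-no : (d : Dec P) → ¬ P → 𝟙 d ≤ 0
𝟙-no (yes p) ¬p = contradiction p ¬p
𝟙-no (no _)  _  = z≤n

𝟙-⊎ : (d : Dec P) (e : Dec Q) (f : Dec R) → (P → Q ⊎ R) → 𝟙 d ≤ 𝟙 e + 𝟙 f
𝟙-⊎ (no _)  e f _ = z≤n
𝟙-⊎ (yes p) e f h with h p
... | inj₁ q = ≤-trans (𝟙-yes e q) (m≤m+n _ _)
... | inj₂ r = ≤-trans (𝟙-yes f r) (m≤n+m _ _)

module _ {F : A → Set} (F? : ∀ x → Dec (F x)) where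

  count : List A → ℕ
  count xs = ∑ xs (λ x → 𝟙 (F? x))

  -- After the first hit, every later entry differs from it and so fails `F`. The bound is `𝟙 r`
  -- rather than 1 so that it can be summed in a double count.
  count-atMostOne : ∀ {xs} (r : Dec R) → Unique xs →
                    (∀ {x y} → F x → F y → x ≡ y) → (∀ {x} → F x → R) →
                    count xs ≤ 𝟙 r
  count-atMostOne r [] same imp = z≤n
  count-atMostOne {xs = x ∷ xs} r (x∉ ∷ u) same imp with F? x
  ... | no _  = count-atMostOne r u same imp
  ... | yes p = ≤-trans (s≤s (none x∉)) (𝟙-yes r (imp p))
    where
    none : ∀ {ys} → All (x ≢_) ys → count ys ≤ 0
    none []         = z≤n
    none (x≢y ∷ ne) = +-mono-≤ (𝟙-no (F? _) (x≢y ∘ same p)) (none ne)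

-- Pigeonhole by induction on the bound: at most one entry takes the top value, and all others lie
-- below it.
count-injective : ∀ {F : A → Set} (F? : ∀ x → Dec (F x)) {xs} k (g : A → ℕ) → Unique xs →
                  (∀ {x} → F x → g x < k) →
                  (∀ {x y} → F x → F y → g x ≡ g y → x ≡ y) →
                  count F? xs ≤ k
count-injective F? {xs} zero g u bounded inj =
  ∑-zero xs (λ x → 𝟙-no (F? x) (λ p → contradiction (bounded p) λ ()))
count-injective {F = F} F? {xs} (suc k) g u bounded inj = begin
  count F? xs                    ≤⟨ ∑-mono xs (λ x → 𝟙-⊎ (F? x) (below? x) (top? x) split) ⟩
  ∑ xs (λ x → 𝟙 (below? x) + 𝟙 (top? x))
                                 ≡⟨ ∑-+ xs _ _ ⟩
  count below? xs + count top? xs ≤⟨ +-mono-≤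
    (count-injective below? k g u proj₂ (λ p q → inj (proj₁ p) (proj₁ q)))
    (count-atMostOne top? (yes tt) u
      (λ p q → inj (proj₁ p) (proj₁ q) (trans (proj₂ p) (sym (proj₂ q)))) (λ _ → tt)) ⟩
  k + 1                          ≡⟨ +-comm k 1 ⟩
  suc k                          ∎
  where
  below? : ∀ x → Dec (F x × g x < k)
  below? x = F? x ×-dec (g x <? k)
  top? : ∀ x → Dec (F x × g x ≡ k)
  top? x = F? x ×-dec (g x ℕ.≟ k)
  split : ∀ {x} → F x → (F x × g x < k) ⊎ (F x × g x ≡ k)
  split p with m≤n⇒m<n∨m≡n (s≤s⁻¹ (bounded p))
  ... | inj₁ lt = inj₁ (p , lt)
  ... | inj₂ eq = inj₂ (p , eq)

Unique-↭ : {xs ys : List A} → xs ↭ ys → Unique xs → Unique ys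
Unique-↭ p = Unique-resp-↭ (setoid _) (↭⇒↭ₛ p)

AllPairs-mapAll : ∀ {F : A → Set} {_∼_ _≈_ : A → A → Set} →
                  (∀ {x y} → F x → F y → x ∼ y → x ≈ y) →
                  ∀ {xs} → All F xs → AllPairs _∼_ xs → AllPairs _≈_ xs
AllPairs-mapAll f []       []       = []
AllPairs-mapAll f (p ∷ ps) (r ∷ rs) =
  All.zipWith (λ (q , s) → f p q s) (ps , r) ∷ AllPairs-mapAll f ps rs

AllPairs-remove : ∀ {_∼_ : A → A → Set} xs {a ys} → AllPairs _∼_ (xs ++ a ∷ ys) →
                  All (_∼ a) xs × AllPairs _∼_ (xs ++ ys)
AllPairs-remove []       (_ ∷ rs) = [] , rs
AllPairs-remove (x ∷ xs) (r ∷ rs) with AllPairs-remove xs rs | All-++⁻ʳ xs r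
... | before , rest | r′ ∷ after = r′ ∷ before , All-++⁺ (All-++⁻ˡ xs r) after ∷ rest

-- Move-to-front on rank functions

module _ {ℓ : ℕ} where

  Ranks : Set
  Ranks = Item ℓ → ℕ

  toFront : Item ℓ → Ranks → Ranks
  toFront a r x with x ≟ a | r x <? r a
  ... | yes _ | _     = 0
  ... | no _  | yes _ = suc (r x)
  ... | no _  | no _  = r x

  data Moved (a : Item ℓ) (r : Ranks) (x : Item ℓ) : ℕ → Set where
    front : x ≡ a → Moved a r x 0
    shift : x ≢ a → r x < r a → Moved a r x (suc (r x))
    stay  : x ≢ a → r a ≤ r x → Moved a r x (r x)

  moved : ∀ a r x → Moved a r x (toFront a r x)
  moved a r x with x ≟ a | r x <? r a
  ... | yes eq | _      = front eq
  ... | no neq | yes lt = shift neq lt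
  ... | no neq | no ≮   = stay neq (≮⇒≥ ≮)

  toFront-self : ∀ a r → toFront a r a ≡ 0
  toFront-self a r with toFront a r a | moved a r a
  ... | _ | front _     = refl
  ... | _ | shift a≢a _ = contradiction refl a≢a
  ... | _ | stay a≢a _  = contradiction refl a≢a

  Injective : Ranks → Set
  Injective r = ∀ {x y} → r x ≡ r y → x ≡ y

  -- Items other than `a` keep their order: a shifted item ends at most at the old rank of `a`, so
  -- it cannot pass an item that stays.
  toFront-reflects-< : ∀ {a x y} r → x ≢ a → toFront a r y < toFront a r x → y ≢ a → r y < r x
  toFront-reflects-< {a} {x} {y} r x≢a lt y≢a
    with toFront a r x | moved a r x | toFront a r y | moved a r y
  ... | _ | front x≡a | _ | _           = contradiction x≡a x≢a
  ... | _ | _         | _ | front y≡a   = contradiction y≡a y≢a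
  ... | _ | shift _ _ | _ | shift _ _   = s≤s⁻¹ lt
  ... | _ | shift _ p | _ | stay _ q    = contradiction (<-≤-trans lt p) (≤⇒≯ q)
  ... | _ | stay _ _  | _ | shift _ _   = <-trans (n<1+n _) lt
  ... | _ | stay _ _  | _ | stay _ _    = lt

  module _ {a : Item ℓ} {r : Ranks} (inj : Injective r) where

    toFront-positive : ∀ {x} → x ≢ a → 0 < toFront a r x
    toFront-positive {x} x≢a with toFront a r x | moved a r x
    ... | _ | front x≡a = contradiction x≡a x≢a
    ... | _ | shift _ _ = s≤s z≤n
    ... | _ | stay _ p  = ≤-<-trans z≤n (≤∧≢⇒< p (x≢a ∘ sym ∘ inj))

    toFront-preserves-< : ∀ {x y} → x ≢ a → r y < r x → toFront a r y < toFront a r x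
    toFront-preserves-< {x} {y} x≢a lt
      with toFront a r y | moved a r y | toFront a r x | moved a r x | toFront-positive x≢a
    ... | _ | front _   | _ | _         | pos = pos
    ... | _ | _         | _ | front x≡a | _ = contradiction x≡a x≢a
    ... | _ | shift _ _ | _ | shift _ _ | _ = s≤s lt
    ... | _ | shift _ p | _ | stay _ q  | _ = ≤-<-trans p (≤∧≢⇒< q (x≢a ∘ sym ∘ inj))
    ... | _ | stay _ q  | _ | shift _ p | _ = contradiction (<-trans lt p) (≤⇒≯ q)
    ... | _ | stay _ _  | _ | stay _ _  | _ = lt

    toFront-injective : Injective (toFront a r)
    toFront-injective {x} {y} eq = by (x ≟ a) (y ≟ a) (<-cmp (r x) (r y))
      where
      by : Dec (x ≡ a) → Dec (y ≡ a) → _ → x ≡ y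
      by (yes x≡a)  (yes y≡a)  _ = trans x≡a (sym y≡a)
      by (yes refl) (no y≢a)   _ =
        contradiction (trans (sym (toFront-self a r)) eq) (<⇒≢ (toFront-positive y≢a))
      by (no x≢a)   (yes refl) _ =
        contradiction (trans (sym (toFront-self a r)) (sym eq)) (<⇒≢ (toFront-positive x≢a))
      by (no x≢a) (no y≢a) (tri< lt _ _) = contradiction eq (<⇒≢ (toFront-preserves-< y≢a lt))
      by (no x≢a) (no y≢a) (tri≈ _ e _)  = inj e
      by (no x≢a) (no y≢a) (tri> _ _ gt) = contradiction (sym eq) (<⇒≢ (toFront-preserves-< x≢a gt))

  -- For an injective `r` this forces the ranks to be exactly the positions in a list, counted from
  -- 0, since distinct ranks give the opposite inequality.
  Dense : Ranks → Set
  Dense r = ∀ x → r x ≤ ∑ (allFin ℓ) (λ y → 𝟙 (r y <? r x))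

  -- Items below `x` stay below it. If `x` is overtaken, its rank grows by one and `a` is the one
  -- new item below it.
  toFront-dense : ∀ {a r} → Injective r → Dense r → Dense (toFront a r)
  toFront-dense {a} {r} inj dense x = by (x ≟ a)
    where
    shifted : ℕ
    shifted = 𝟙 (r x <? r a)
    by : Dec (x ≡ a) → _
    by (yes refl) = ≤-trans (≤-reflexive (toFront-self x r)) z≤n
    by (no x≢a)   = begin
      toFront a r x                            ≤⟨ grow ⟩
      r x + shifted                            ≤⟨ +-monoˡ-≤ shifted (dense x) ⟩
      ∑ (allFin ℓ) (λ y → 𝟙 (r y <? r x)) + shifted
        ≤⟨ ∑-mono-at shifted 0 (∈-allFin a)
             (λ y → 𝟙-mono (r y <? r x) (toFront a r y <? toFront a r x)
                           (toFront-preserves-< inj x≢a)) atFront ⟩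
      ∑ (allFin ℓ) (λ y → 𝟙 (toFront a r y <? toFront a r x)) + 0
        ≡⟨ +-identityʳ _ ⟩
      ∑ (allFin ℓ) (λ y → 𝟙 (toFront a r y <? toFront a r x)) ∎
      where
      grow : toFront a r x ≤ r x + shifted
      grow with toFront a r x | moved a r x
      ... | _ | front _   = z≤n
      ... | _ | shift _ p =
          ≤-trans (≤-reflexive (+-comm 1 (r x))) (+-monoʳ-≤ (r x) (𝟙-yes (r x <? r a) p))
      ... | _ | stay _ _  = m≤m+n _ _
      -- Either `a` was already below `x`, or `x` is overtaken now, never both; afterwards `a` is
      -- below `x` in any case.
      atFront : 𝟙 (r a <? r x) + shifted ≤ 𝟙 (toFront a r a <? toFront a r x) + 0
      atFront = begin
        𝟙 (r a <? r x) + 𝟙 (r x <? r a) ≤⟨ exclusive (r a <? r x) (r x <? r a) ⟩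
        1                                ≤⟨ 𝟙-yes (toFront a r a <? toFront a r x)
          (subst (_< toFront a r x) (sym (toFront-self a r)) (toFront-positive inj x≢a)) ⟩
        𝟙 (toFront a r a <? toFront a r x) ≡⟨ +-identityʳ _ ⟨
        𝟙 (toFront a r a <? toFront a r x) + 0 ∎
        where
        exclusive : (d : Dec (r a < r x)) (e : Dec (r x < r a)) → 𝟙 d + 𝟙 e ≤ 1
        exclusive (yes p) (yes q) = contradiction p (<-asym q)
        exclusive (yes p) (no _)  = ≤-refl
        exclusive (no _)  e       = 𝟙-≤1 e

  costMTF : Ranks → List (Item ℓ) → ℕ
  costMTF r []      = 0
  costMTF r (a ∷ M) = suc (r a) + costMTF (toFront a r) M

-- A process list against a schedule

module _ {ℓ : ℕ} where

  below : Ranks {ℓ} → Item ℓ → List (Item ℓ) → ℕ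
  below r x L = ∑ L (λ y → 𝟙 (r y <? r x))

  inversions : Ranks {ℓ} → List (Item ℓ) → ℕ
  inversions r []      = 0
  inversions r (x ∷ L) = below r x L + inversions r L

  -- The prefix contributes only through counts over what follows it, and these do not depend on the
  -- order there.
  inversions-++ : ∀ {r c L L′} xs → L ↭ L′ → inversions r L ≤ c + inversions r L′ →
                  inversions r (xs ++ L) ≤ c + inversions r (xs ++ L′)
  inversions-++ []       p le = le
  inversions-++ {r} {c} {L} {L′} (x ∷ xs) p le = begin
    below r x (xs ++ L) + inversions r (xs ++ L)
      ≤⟨ +-mono-≤ (≤-reflexive (∑-↭ _ (↭-++⁺ˡ xs p))) (inversions-++ {r} {c} xs p le) ⟩
    below r x (xs ++ L′) + (c + inversions r (xs ++ L′))
      ≡⟨ exch (below r x (xs ++ L′)) c _ ⟩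
    c + (below r x (xs ++ L′) + inversions r (xs ++ L′)) ∎
    where
    exch : ∀ a b c → a + (b + c) ≡ b + (a + c)
    exch = solve-∀

  -- Only pairs of `a` with an item of `ys` change. Passing `y` creates an inversion only if `y` has
  -- the smaller rank; inversions that disappear are given away.
  inversions-forward : ∀ r xs ys a zs →
    inversions r (xs ++ a ∷ ys ++ zs) ≤ below r a ys + inversions r (xs ++ ys ++ a ∷ zs)
  inversions-forward r xs ys a zs = inversions-++ xs (↭-sym (↭-shift a ys zs)) (cross ys)
    where
    cross : ∀ ys → inversions r (a ∷ ys ++ zs) ≤ below r a ys + inversions r (ys ++ a ∷ zs)
    cross []       = ≤-refl
    cross (y ∷ ys) = begin
      𝟙 (r y <? r a) + below r a (ys ++ zs) + (below r y (ys ++ zs) + inversions r (ys ++ zs))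
        ≡⟨ lhs (𝟙 (r y <? r a)) (below r a (ys ++ zs)) (below r y (ys ++ zs)) _ ⟩
      𝟙 (r y <? r a) + (below r y (ys ++ zs) + inversions r (a ∷ ys ++ zs))
        ≤⟨ +-monoʳ-≤ (𝟙 (r y <? r a)) (+-mono-≤ belowStep (cross ys)) ⟩
      𝟙 (r y <? r a) + (below r y (ys ++ a ∷ zs) + (below r a ys + inversions r (ys ++ a ∷ zs)))
        ≡⟨ rhs (𝟙 (r y <? r a)) (below r y (ys ++ a ∷ zs)) (below r a ys) _ ⟩
      below r a (y ∷ ys) + inversions r (y ∷ ys ++ a ∷ zs) ∎
      where
      lhs : ∀ p q t u → p + q + (t + u) ≡ p + (t + (q + u))
      lhs = solve-∀
      rhs : ∀ p q t u → p + (q + (t + u)) ≡ p + t + (q + u)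
      rhs = solve-∀
      belowStep : below r y (ys ++ zs) ≤ below r y (ys ++ a ∷ zs)
      belowStep = ≤-trans (m≤n+m _ _) (≤-reflexive (sym (∑-↭ _ (↭-shift a ys zs))))

  below≤length : ∀ r a ys → below r a ys ≤ length ys
  below≤length r a ys = begin
    below r a ys       ≤⟨ ∑-mono ys (λ y → 𝟙-≤1 (r y <? r a)) ⟩
    ∑ ys (λ _ → 1)     ≡⟨ ∑-const ys 1 ⟩
    length ys * 1      ≡⟨ *-identityʳ _ ⟩
    length ys          ∎

  below-minimum : ∀ r a ys → r a ≡ 0 → below r a ys ≤ 0
  below-minimum r a ys ra≡0 =
    ∑-zero ys (λ y → 𝟙-no (r y <? r a) (λ lt → contradiction (subst (r y <_) ra≡0 lt) λ ()))

  -- No pair without `a` becomes inverted. Each item of `w` gains at most one inversion with `a`,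
  -- and each item of `zs` with smaller rank than `a` loses one, which puts `below r a zs` on the
  -- left.
  inversions-toFront : ∀ {a} r w {zs} → All (_≢ a) w → All (_≢ a) zs →
    inversions (toFront a r) (w ++ a ∷ zs) + below r a zs ≤ length w + inversions r (w ++ a ∷ zs)
  inversions-toFront {a} r w {zs} w≢a zs≢a = go w w≢a
    where
    r′ : Ranks
    r′ = toFront a r
    below-≤ : ∀ {x} L → x ≢ a → All (_≢ a) L → below r′ x L ≤ below r x L
    below-≤ {x} L x≢a L≢a = ∑-monoAll
      (All.map (λ {y} y≢a → 𝟙-mono (r′ y <? r′ x) (r y <? r x)
                                     λ lt → toFront-reflects-< r x≢a lt y≢a) L≢a)
    inversions-≤ : ∀ {L} → All (_≢ a) L → inversions r′ L ≤ inversions r L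
    inversions-≤ []            = z≤n
    inversions-≤ (x≢a ∷ L≢a)   = +-mono-≤ (below-≤ _ x≢a L≢a) (inversions-≤ L≢a)
    go : ∀ w → All (_≢ a) w →
         inversions r′ (w ++ a ∷ zs) + below r a zs ≤ length w + inversions r (w ++ a ∷ zs)
    go [] [] = begin
      below r′ a zs + inversions r′ zs + below r a zs
        ≤⟨ +-monoˡ-≤ _ (+-mono-≤ (below-minimum r′ a zs (toFront-self a r)) (inversions-≤ zs≢a)) ⟩
      inversions r zs + below r a zs  ≡⟨ +-comm (inversions r zs) _ ⟩
      below r a zs + inversions r zs  ∎
    go (x ∷ w) (x≢a ∷ w≢a) = begin
      below r′ x (w ++ a ∷ zs) + inversions r′ (w ++ a ∷ zs) + below r a zs
        ≡⟨ +-assoc (below r′ x (w ++ a ∷ zs)) _ _ ⟩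
      below r′ x (w ++ a ∷ zs) + (inversions r′ (w ++ a ∷ zs) + below r a zs)
        ≤⟨ +-mono-≤ row (go w w≢a) ⟩
      1 + below r x (w ++ a ∷ zs) + (length w + inversions r (w ++ a ∷ zs))
        ≡⟨ exch (below r x (w ++ a ∷ zs)) (length w) _ ⟩
      suc (length w) + (below r x (w ++ a ∷ zs) + inversions r (w ++ a ∷ zs)) ∎
      where
      exch : ∀ p q t → 1 + p + (q + t) ≡ 1 + q + (p + t)
      exch = solve-∀
      row : below r′ x (w ++ a ∷ zs) ≤ 1 + below r x (w ++ a ∷ zs)
      row = begin
        below r′ x (w ++ a ∷ zs)                  ≡⟨ ∑-↭ _ (↭-shift a w zs) ⟩
        𝟙 (r′ a <? r′ x) + below r′ x (w ++ zs)
          ≤⟨ +-mono-≤ (𝟙-≤1 (r′ a <? r′ x)) (below-≤ (w ++ zs) x≢a (All-++⁺ w≢a zs≢a)) ⟩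
        1 + below r x (w ++ zs)                   ≤⟨ s≤s (m≤n+m _ (𝟙 (r a <? r x))) ⟩
        1 + below r x (a ∷ w ++ zs)               ≡⟨ cong suc (∑-↭ _ (↭-shift a w zs)) ⟨
        1 + below r x (w ++ a ∷ zs)               ∎

  -- Sleator and Tarjan's potential argument; the item is moved to the front
  -- in the MTF order while the other list is still unchanged.
  access-amortized : ∀ {a} r w zs → Dense r → w ++ a ∷ zs ↭ allFin ℓ →
    r a + inversions (toFront a r) (w ++ a ∷ zs) ≤ 2 * length w + inversions r (w ++ a ∷ zs)
  access-amortized {a} r w zs dense p = begin
    r a + inversions r′ (w ++ a ∷ zs)
      ≤⟨ +-monoˡ-≤ _ rank ⟩
    length w + below r a zs + inversions r′ (w ++ a ∷ zs)
      ≡⟨ exch (length w) _ _ ⟩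
    length w + (inversions r′ (w ++ a ∷ zs) + below r a zs)
      ≤⟨ +-monoʳ-≤ (length w) (inversions-toFront r w w≢a zs≢a) ⟩
    length w + (length w + inversions r (w ++ a ∷ zs))
      ≡⟨ double (length w) _ ⟩
    2 * length w + inversions r (w ++ a ∷ zs) ∎
    where
    r′ : Ranks
    r′ = toFront a r
    exch : ∀ p q t → p + q + t ≡ p + (t + q)
    exch = solve-∀
    double : ∀ p q → p + (p + q) ≡ 2 * p + q
    double = solve-∀
    distinct : Unique (a ∷ w ++ zs)
    distinct = Unique-↭ (↭-trans (↭-sym p) (↭-shift a w zs)) (allFin⁺ ℓ)
    ≢a : All (_≢ a) (w ++ zs)
    ≢a with distinct
    ... | a≢ ∷ _ = All.map (_∘ sym) a≢
    w≢a : All (_≢ a) w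
    w≢a = All-++⁻ˡ w ≢a
    zs≢a : All (_≢ a) zs
    zs≢a = All-++⁻ʳ w ≢a
    rank : r a ≤ length w + below r a zs
    rank = begin
      r a                                        ≤⟨ dense a ⟩
      below r a (allFin ℓ)                       ≡⟨ ∑-↭ _ p ⟨
      below r a (w ++ a ∷ zs)                    ≡⟨ ∑-++ w (a ∷ zs) _ ⟩
      below r a w + (𝟙 (r a <? r a) + below r a zs)
        ≤⟨ +-mono-≤ (below≤length r a w) (+-monoˡ-≤ _ (𝟙-no (r a <? r a) (<-irrefl refl))) ⟩
      length w + below r a zs                    ∎

  access-↭ : ∀ xs ys {a : Item ℓ} {zs} → xs ++ a ∷ ys ++ zs ↭ xs ++ ys ++ a ∷ zs
  access-↭ xs ys = ↭-++⁺ˡ xs (↭-sym (↭-shift _ ys _))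

module _ {p ℓ : ℕ} where

  requestsBy : Fin p → List (Request p ℓ) → List (Item ℓ)
  requestsBy i M = map item (filter (λ q → process q ≟ i) M)

  -- Induction on the schedule with the inversions as potential. An exchange creates at most one. A
  -- request of another process leaves `r` alone, and its free move crosses fewer items than the
  -- access costs. A request of process `i` is handled by `access-amortized`. The equation for `N`
  -- lets the schedule be matched while `M` keeps the names of the processes.
  costMTF≤2cost : ∀ i {L N} (S : Schedule L N) M → N ≡ map item M → L ↭ allFin ℓ →
                  ∀ r → Injective r → Dense r →
                  costMTF r (requestsBy i M) ≤ 2 * cost S + inversions r L
  costMTF≤2cost i [] [] _ _ r _ _ = z≤n
  costMTF≤2cost i (exchange xs a b ys S) M eq π r inj dense = begin
    costMTF r (requestsBy i M)
      ≤⟨ costMTF≤2cost i S M eq (↭-trans (access-↭ xs (a ∷ [])) π) r inj dense ⟩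
    2 * cost S + inversions r (xs ++ b ∷ a ∷ ys)
      ≤⟨ +-monoʳ-≤ (2 * cost S) (inversions-forward r xs (a ∷ []) b ys) ⟩
    2 * cost S + (below r b (a ∷ []) + inversions r (xs ++ a ∷ b ∷ ys))
      ≤⟨ +-monoʳ-≤ (2 * cost S) (+-monoˡ-≤ _ (≤-trans (below≤length r b (a ∷ [])) (n≤1+n 1))) ⟩
    2 * cost S + (2 + inversions r (xs ++ a ∷ b ∷ ys))
      ≡⟨ exch (cost S) _ ⟩
    2 * suc (cost S) + inversions r (xs ++ a ∷ b ∷ ys) ∎
    where
    exch : ∀ c v → 2 * c + (2 + v) ≡ 2 * suc c + v
    exch = solve-∀
  costMTF≤2cost i (access xs ys a zs S) ((j , .a) ∷ M) refl π r inj dense with j ≟ i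
  ... | no _ = begin
    costMTF r (requestsBy i M)
      ≤⟨ costMTF≤2cost i S M refl (↭-trans (access-↭ xs ys) π) r inj dense ⟩
    2 * cost S + inversions r (xs ++ a ∷ ys ++ zs)
      ≤⟨ +-monoʳ-≤ (2 * cost S) (inversions-forward r xs ys a zs) ⟩
    2 * cost S + (below r a ys + inversions r (xs ++ ys ++ a ∷ zs))
      ≤⟨ +-monoʳ-≤ (2 * cost S) (+-monoˡ-≤ _ charge) ⟩
    2 * cost S + (2 * suc (length (xs ++ ys)) + inversions r (xs ++ ys ++ a ∷ zs))
      ≡⟨ exch (cost S) (suc (length (xs ++ ys))) _ ⟩
    2 * (suc (length (xs ++ ys)) + cost S) + inversions r (xs ++ ys ++ a ∷ zs) ∎
    where
    exch : ∀ c k v → 2 * c + (2 * k + v) ≡ 2 * (k + c) + v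
    exch = solve-∀
    charge : below r a ys ≤ 2 * suc (length (xs ++ ys))
    charge = begin
      below r a ys                   ≤⟨ below≤length r a ys ⟩
      length ys                      ≤⟨ m≤n+m _ (length xs) ⟩
      length xs + length ys          ≡⟨ length-++ xs ⟨
      length (xs ++ ys)              ≤⟨ n≤1+n _ ⟩
      suc (length (xs ++ ys))        ≤⟨ m≤m+n _ _ ⟩
      2 * suc (length (xs ++ ys))    ∎
  ... | yes refl = begin
    suc (r a) + costMTF r′ (requestsBy i M)
      ≤⟨ +-monoʳ-≤ (suc (r a)) (costMTF≤2cost i S M refl (↭-trans (access-↭ xs ys) π) r′
           (toFront-injective inj) (toFront-dense inj dense)) ⟩
    suc (r a) + (2 * cost S + inversions r′ (xs ++ a ∷ ys ++ zs))
      -- By now `a` has rank 0, so moving it across `ys` creates no inversion.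
      ≤⟨ +-monoʳ-≤ (suc (r a)) (+-monoʳ-≤ (2 * cost S) (≤-trans (inversions-forward r′ xs ys a zs)
           (+-monoˡ-≤ _ (below-minimum r′ a ys (toFront-self a r))))) ⟩
    suc (r a) + (2 * cost S + inversions r′ (xs ++ ys ++ a ∷ zs))
      ≡⟨ exch₁ (r a) (2 * cost S) _ ⟩
    suc (2 * cost S + (r a + inversions r′ (xs ++ ys ++ a ∷ zs)))
      ≤⟨ s≤s (+-monoʳ-≤ (2 * cost S) amortized) ⟩
    suc (2 * cost S + (2 * length (xs ++ ys) + inversions r (xs ++ ys ++ a ∷ zs)))
      -- Slack: an access of cost `n` has been charged at most `2 * n - 1`.
      ≤⟨ n≤1+n _ ⟩
    suc (suc (2 * cost S + (2 * length (xs ++ ys) + inversions r (xs ++ ys ++ a ∷ zs))))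
      ≡⟨ exch₂ (cost S) (length (xs ++ ys)) _ ⟩
    2 * (suc (length (xs ++ ys)) + cost S) + inversions r (xs ++ ys ++ a ∷ zs) ∎
    where
    r′ : Ranks
    r′ = toFront a r
    exch₁ : ∀ k c v → suc k + (c + v) ≡ suc (c + (k + v))
    exch₁ = solve-∀
    exch₂ : ∀ c k v → suc (suc (2 * c + (2 * k + v))) ≡ 2 * (suc k + c) + v
    exch₂ = solve-∀
    amortized : r a + inversions r′ (xs ++ ys ++ a ∷ zs) ≤
                2 * length (xs ++ ys) + inversions r (xs ++ ys ++ a ∷ zs)
    amortized = subst (λ L → L ↭ allFin ℓ →
                             r a + inversions r′ L ≤ 2 * length (xs ++ ys) + inversions r L)
                      (++-assoc xs ys (a ∷ zs)) (access-amortized r (xs ++ ys) zs dense) π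

-- Initial ranks

module _ {ℓ : ℕ} where

  index : List (Item ℓ) → Ranks
  index []      x = 0
  index (y ∷ L) x with x ≟ y
  ... | yes _ = 0
  ... | no _  = suc (index L x)

  -- An absent item gets the value `length L`, which no member of `L` attains, so membership of `x`
  -- decides the matter.
  index-injective : ∀ L {x y} → x ∈ L → index L x ≡ index L y → x ≡ y
  index-injective (z ∷ L) {x} {y} x∈ eq with x ≟ z | y ≟ z | x∈
  ... | yes x≡z | yes y≡z | _         = trans x≡z (sym y≡z)
  ... | no x≢z  | no _    | here x≡z  = contradiction x≡z x≢z
  ... | no _    | no _    | there x∈L = index-injective L x∈L (suc-injective eq)
  ... | yes _   | no _    | _         with () ← eq
  ... | no _    | yes _   | _         with () ← eq

  index-dense : ∀ L x → index L x ≤ below (index L) x L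
  index-dense []      x = z≤n
  index-dense (z ∷ L) x with x ≟ z
  ... | yes _ = z≤n
  ... | no _  = +-mono-≤ (𝟙-yes (index (z ∷ L) z <? suc (index L x)) first)
                  (≤-trans (index-dense L x)
                    (∑-mono L λ y →
                       𝟙-mono (index L y <? index L x) (index (z ∷ L) y <? suc (index L x))
                       (λ lt → ≤-trans (s≤s (later y)) (s≤s lt))))
    where
    first : index (z ∷ L) z < suc (index L x)
    first with z ≟ z
    ... | yes _  = s≤s z≤n
    ... | no z≢z = contradiction refl z≢z
    -- Only an inequality: `z` may occur again in `L`, while its index in `z ∷ L` is 0.
    later : ∀ y → index (z ∷ L) y ≤ suc (index L y)
    later y with y ≟ z
    ... | yes _ = z≤n
    ... | no _  = ≤-refl

  index-increasing : ∀ {L} → Unique L → AllPairs (λ x y → index L x < index L y) L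
  index-increasing []               = []
  index-increasing {z ∷ L} (z≢ ∷ u) =
    All.map (λ z≢y → subst (_ <_) (sym (later z≢y)) (s≤s (≤-trans (≤-reflexive first) z≤n))) z≢ ∷
    AllPairs-mapAll (λ z≢x z≢y lt → ≤-trans (s≤s (≤-reflexive (later z≢x)))
                        (≤-trans (s≤s lt) (≤-reflexive (sym (later z≢y)))))
      z≢ (index-increasing u)
    where
    first : index (z ∷ L) z ≡ 0
    first with z ≟ z
    ... | yes _  = refl
    ... | no z≢z = contradiction refl z≢z
    later : ∀ {y} → z ≢ y → index (z ∷ L) y ≡ suc (index L y)
    later {y} z≢y with y ≟ z
    ... | yes y≡z = contradiction (sym y≡z) z≢y
    ... | no _    = refl

  inversions-increasing : ∀ r {L : List (Item ℓ)} → AllPairs (λ x y → r x < r y) L →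
                          inversions r L ≤ 0
  inversions-increasing r []            = z≤n
  inversions-increasing r {x ∷ L} (lts ∷ ps) =
    +-mono-≤ (≤-trans (∑-monoAll (All.map (λ {y} lt → 𝟙-no (r y <? r x) (<-asym lt)) lts))
                       (∑-zero L (λ _ → ≤-refl)))
      (inversions-increasing r ps)

-- The potential of the merged list

module _ {p ℓ : ℕ} where

  _≟ʳ_ : DecidableEquality (Request p ℓ)
  _≟ʳ_ = ≡-dec _≟_ _≟_

  requests : List (Request p ℓ)
  requests = cartesianProduct (allFin p) (allFin ℓ)

  requests-unique : Unique requests
  requests-unique = cartesianProduct⁺ (allFin⁺ p) (allFin⁺ ℓ)

  ProcessRanks : Set
  ProcessRanks = Fin p → Ranks {ℓ}

  rank : ProcessRanks → Request p ℓ → ℕ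
  rank r u = r (process u) (item u)

  advance : Request p ℓ → ProcessRanks → ProcessRanks
  advance e r j with process e ≟ j
  ... | yes _ = toFront (item e) (r j)
  ... | no _  = r j

  advance-self : ∀ e r → rank (advance e r) e ≡ 0
  advance-self (i , a) r with i ≟ i
  ... | yes _  = toFront-self a (r i)
  ... | no i≢i = contradiction refl i≢i

  Advanced : Request p ℓ → ProcessRanks → Request p ℓ → Set
  Advanced e r u =
    rank (advance e r) u ≡ rank r u ⊎
    (process u ≡ process e × rank r u < rank r e × rank (advance e r) u ≡ suc (rank r u))

  advance-other : ∀ {e u} r → u ≢ e → Advanced e r u
  advance-other {i , a} {j , x} r u≢e with i ≟ j
  ... | no _ = inj₁ refl
  ... | yes refl with toFront a (r i) x | moved a (r i) x
  ...   | _ | front refl = contradiction refl u≢e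
  ...   | _ | shift _ lt = inj₂ (refl , lt , refl)
  ...   | _ | stay _ _   = inj₁ refl

  advance-injective : ∀ {e r} → (∀ j → Injective (r j)) → ∀ j → Injective (advance e r j)
  advance-injective {e} {r} inj j with process e ≟ j
  ... | yes _ = toFront-injective (inj j)
  ... | no _  = inj j

  costMTFs : ProcessRanks → List (Request p ℓ) → ℕ
  costMTFs r []      = 0
  costMTFs r (e ∷ M) = suc (rank r e) + costMTFs (advance e r) M

  -- A request advances only the list of its own process, so `∑-mono-at` books its cost in that
  -- summand.
  costMTFs≤∑costMTF : ∀ r M → costMTFs r M ≤ ∑ (allFin p) (λ j → costMTF (r j) (requestsBy j M))
  costMTFs≤∑costMTF r []            = z≤n
  costMTFs≤∑costMTF r ((i , a) ∷ M) = begin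
    suc (r i a) + costMTFs r′ M
      ≤⟨ +-monoʳ-≤ (suc (r i a)) (costMTFs≤∑costMTF r′ M) ⟩
    suc (r i a) + ∑ (allFin p) (λ j → costMTF (r′ j) (requestsBy j M))
      ≡⟨ +-comm (suc (r i a)) _ ⟩
    ∑ (allFin p) (λ j → costMTF (r′ j) (requestsBy j M)) + suc (r i a)
      ≤⟨ ∑-mono-at (suc (r i a)) 0 (∈-allFin i) others own ⟩
    ∑ (allFin p) (λ j → costMTF (r j) (requestsBy j ((i , a) ∷ M))) + 0
      ≡⟨ +-identityʳ _ ⟩
    ∑ (allFin p) (λ j → costMTF (r j) (requestsBy j ((i , a) ∷ M))) ∎
    where
    r′ : ProcessRanks
    r′ = advance (i , a) r
    others : ∀ j → costMTF (r′ j) (requestsBy j M) ≤ costMTF (r j) (requestsBy j ((i , a) ∷ M))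
    others j with i ≟ j
    ... | yes _ = m≤n+m _ (suc (r j a))
    ... | no _  = ≤-refl
    own : costMTF (r′ i) (requestsBy i M) + suc (r i a) ≤
          costMTF (r i) (requestsBy i ((i , a) ∷ M)) + 0
    own with i ≟ i
    ... | yes _  = ≤-reflexive (trans (+-comm _ (suc (r i a))) (sym (+-identityʳ _)))
    ... | no i≢i = contradiction refl i≢i

  -- T (b u v) says that, in a merged list holding one copy of every item for
  -- each process, the copy u is in front of the copy v.
  Order : Set
  Order = Request p ℓ → Request p ℓ → Bool

  -- The test on `v` comes first, so that nothing, not even `e` itself, ends in front of `e`.
  bring : Request p ℓ → Order → Order
  bring e b u v with v ≟ʳ e | u ≟ʳ e
  ... | yes _ | _     = false
  ... | no _  | yes _ = true
  ... | no _  | no _  = b u v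

  bring-target : ∀ e b u → ¬ T (bring e b u e)
  bring-target e b u t with e ≟ʳ e
  ... | yes _  = t
  ... | no e≢e = e≢e refl

  bring-source : ∀ e b {v} → v ≢ e → T (bring e b e v)
  bring-source e b {v} v≢e with v ≟ʳ e | e ≟ʳ e
  ... | yes v≡e | _      = contradiction v≡e v≢e
  ... | no _    | yes _  = _
  ... | no _    | no e≢e = contradiction refl e≢e

  bring-keep : ∀ e b {u v} → v ≢ e → T (b u v) → T (bring e b u v)
  bring-keep e b {u} {v} v≢e t with v ≟ʳ e | u ≟ʳ e
  ... | yes v≡e | _     = contradiction v≡e v≢e
  ... | no _    | yes _ = _
  ... | no _    | no _  = t

  bring-old : ∀ e b {u v} → u ≢ e → T (bring e b u v) → T (b u v)
  bring-old e b {u} {v} u≢e t with v ≟ʳ e | u ≟ʳ e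
  ... | no _ | yes u≡e = contradiction u≡e u≢e
  ... | no _ | no _    = t

  -- This confines discordant pairs to copies of different processes, and it saves one in the count
  -- of near copies of the requesting process.
  record Consistent (r : ProcessRanks) (b : Order) : Set where
    field
      injective : ∀ j → Injective (r j)
      ordered   : ∀ {u v} → process u ≡ process v → T (b u v) → rank r u < rank r v
  open Consistent

  consistent-step : ∀ {r b} e → Consistent r b → Consistent (advance e r) (bring e b)
  consistent-step e c .injective = advance-injective {e} (c .injective)
  consistent-step {r} {b} e@(i , a) c .ordered {j , y} {.j , x} refl t =
    by ((j , y) ≟ʳ e) ((j , x) ≟ʳ e)
    where
    by : Dec ((j , y) ≡ e) → Dec ((j , x) ≡ e) → advance e r j y < advance e r j x
    by _          (yes refl) = contradiction t (bring-target e b (j , y))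
    by (yes refl) (no x≢e) with i ≟ i
    ... | yes _  = subst (_< toFront a (r i) x) (sym (toFront-self a (r i)))
                     (toFront-positive (c .injective i) (x≢e ∘ cong (i ,_)))
    ... | no i≢i = contradiction refl i≢i
    by (no y≢e) (no x≢e) with i ≟ j
    ... | no _     = c .ordered refl (bring-old e b y≢e t)
    ... | yes refl = toFront-preserves-< (c .injective i) (x≢e ∘ cong (i ,_))
                       (c .ordered refl (bring-old e b y≢e t))

  -- A disagreement is recorded in one direction only, with the copy of smaller rank first. Equal
  -- ranks are no disagreement.
  Discordant : ProcessRanks → Order → (u v : Request p ℓ) → Set
  Discordant r b u v = T (b v u) × rank r u < rank r v

  discordant? : ∀ r b u v → Dec (Discordant r b u v)
  discordant? r b u v = T? (b v u) ×-dec (rank r u <? rank r v)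

  discord : ProcessRanks → Order → ℕ
  discord r b = ∑ requests (λ u → count (discordant? r b u) requests)

  module Step {r : ProcessRanks} {b : Order} (c : Consistent r b) (e : Request p ℓ) where

    k : ℕ
    k = rank r e

    r′ : ProcessRanks
    r′ = advance e r

    b′ : Order
    b′ = bring e b

    Ahead : Request p ℓ → Set
    Ahead v = T (b v e)

    ahead? : ∀ v → Dec (Ahead v)
    ahead? v = T? (b v e)

    -- The copies in front of `e` that the potential does not pay for: those of larger rank form
    -- discordant pairs with `e`, which disappear.
    Near : Request p ℓ → Set
    Near v = Ahead v × rank r v ≤ k

    near? : ∀ v → Dec (Near v)
    near? v = ahead? v ×-dec (rank r v ≤? k)

    Overtaken : Request p ℓ → Set
    Overtaken v = process v ≡ process e × rank r v < k

    overtaken? : ∀ v → Dec (Overtaken v)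
    overtaken? v = (process v ≟ process e) ×-dec (rank r v <? k)

    -- The candidates for new discordant pairs: a tie that is broken when `e` pushes `v` back by
    -- one.
    Fresh : Request p ℓ → Request p ℓ → Set
    Fresh u v = Overtaken v × process u ≢ process e × rank r u ≡ rank r v

    fresh? : ∀ u v → Dec (Fresh u v)
    fresh? u v = overtaken? v ×-dec ¬? (process u ≟ process e) ×-dec (rank r u ℕ.≟ rank r v)

    discordant-self : ∀ v → ¬ Discordant r′ b′ e v
    discordant-self v (t , _) = bring-target e b v t

    -- The copy `e` ends in front in both orders and so lies in no discordant pair. For other copies
    -- the merged order is unchanged and ranks grow by at most one, so a new pair needs a former
    -- tie; within one process consistency excludes a tie.
    discordant-step : ∀ {u v} → Discordant r′ b′ u v → Discordant r b u v ⊎ Fresh u v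
    discordant-step {u} {v} (t , lt) = by (v ≟ʳ e) (u ≟ʳ e)
      where
      by : Dec (v ≡ e) → Dec (u ≡ e) → Discordant r b u v ⊎ Fresh u v
      by (yes refl) _          = contradiction (subst (rank r′ u <_) (advance-self e r) lt) λ ()
      by _          (yes refl) = contradiction t (bring-target e b v)
      by (no v≢e)   (no u≢e)   = inner (advance-other r u≢e) (advance-other r v≢e)
        where
        old : T (b v u)
        old = bring-old e b v≢e t
        grows : ∀ {w} → Advanced e r w → rank r w ≤ rank r′ w
        grows (inj₁ eq)           = ≤-reflexive (sym eq)
        grows (inj₂ (_ , _ , eq)) = ≤-trans (n≤1+n _) (≤-reflexive (sym eq))
        inner : Advanced e r u → Advanced e r v → Discordant r b u v ⊎ Fresh u v
        inner mu (inj₁ eq) = inj₁ (old , ≤-<-trans (grows mu) (subst (rank r′ u <_) eq lt))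
        inner mu (inj₂ (pv , v<k , eq))
          with m≤n⇒m<n∨m≡n (≤-trans (grows mu) (s≤s⁻¹ (subst (rank r′ u <_) eq lt)))
        ... | inj₁ u<v = inj₁ (old , u<v)
        ... | inj₂ u≡v = inj₂ ((pv , v<k) ,
              (λ pu → contradiction (sym u≡v) (<⇒≢ (c .ordered (trans pv (sym pu)) old))) , u≡v)

    -- The row of `e` becomes empty. It held every copy in front of `e` with rank above `k`, so its
    -- loss pays for all copies ahead except the near ones; every other row gains only fresh pairs.
    discord-step : discord r′ b′ + count ahead? requests ≤
                   discord r b + (∑ requests (λ u → count (fresh? u) requests) + count near? requests)
    discord-step = begin
      discord r′ b′ + count ahead? requests
        ≤⟨ ∑-mono-at (count ahead? requests) (count near? requests)
             (∈-cartesianProduct⁺ (∈-allFin (process e)) (∈-allFin (item e))) rows own ⟩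
      ∑ requests (λ u → count (discordant? r b u) requests + count (fresh? u) requests) + count near? requests
        ≡⟨ cong (_+ count near? requests) (∑-+ requests _ _) ⟩
      discord r b + ∑ requests (λ u → count (fresh? u) requests) + count near? requests
        ≡⟨ +-assoc (discord r b) _ _ ⟩
      discord r b + (∑ requests (λ u → count (fresh? u) requests) + count near? requests) ∎
      where
      rows : ∀ u → count (discordant? r′ b′ u) requests ≤
                   count (discordant? r b u) requests + count (fresh? u) requests
      rows u = begin
        count (discordant? r′ b′ u) requests
          ≤⟨ ∑-mono requests (λ v →
               𝟙-⊎ (discordant? r′ b′ u v) (discordant? r b u v) (fresh? u v) discordant-step) ⟩
        ∑ requests (λ v → 𝟙 (discordant? r b u v) + 𝟙 (fresh? u v))
          ≡⟨ ∑-+ requests _ _ ⟩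
        count (discordant? r b u) requests + count (fresh? u) requests ∎
      split : ∀ {v} → Ahead v → Discordant r b e v ⊎ Near v
      split {v} t with rank r v ≤? k
      ... | yes le = inj₂ (t , le)
      ... | no ≰   = inj₁ (t , ≰⇒> ≰)
      own : count (discordant? r′ b′ e) requests + count ahead? requests ≤
            count (discordant? r b e) requests + count (fresh? e) requests + count near? requests
      own = begin
        count (discordant? r′ b′ e) requests + count ahead? requests
          ≤⟨ +-mono-≤ (∑-zero requests (λ v → 𝟙-no (discordant? r′ b′ e v) (discordant-self v)))
               (∑-mono requests (λ v → 𝟙-⊎ (ahead? v) (discordant? r b e v) (near? v) split)) ⟩
        ∑ requests (λ v → 𝟙 (discordant? r b e v) + 𝟙 (near? v))
          ≡⟨ ∑-+ requests _ _ ⟩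
        count (discordant? r b e) requests + count near? requests
          ≤⟨ +-monoˡ-≤ (count near? requests) (m≤m+n (count (discordant? r b e) requests) _) ⟩
        count (discordant? r b e) requests + count (fresh? e) requests + count near? requests ∎

    freshOf nearOf : Fin p → ℕ
    freshOf j = ∑ (allFin ℓ) (λ x → count (fresh? (j , x)) requests)
    nearOf j  = ∑ (allFin ℓ) (λ y → 𝟙 (near? (j , y)))

    freshOf-own : freshOf (process e) ≤ 0
    freshOf-own = ∑-zero (allFin ℓ) λ x → ∑-zero requests λ v →
      𝟙-no (fresh? (process e , x) v) (λ (_ , ≢ , _) → ≢ refl)

    -- Double count by the overtaken copy: it has at most one partner of equal rank in process `j`,
    -- and at most `k` copies are overtaken, since their ranks are distinct and below `k`.
    freshOf≤ : ∀ j → freshOf j ≤ k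
    freshOf≤ j = begin
      freshOf j
        ≡⟨ ∑-swap (allFin ℓ) requests _ ⟩
      ∑ requests (λ v → ∑ (allFin ℓ) (λ x → 𝟙 (fresh? (j , x) v)))
        ≤⟨ ∑-mono requests (λ v → count-atMostOne (λ x → fresh? (j , x) v) (overtaken? v) (allFin⁺ ℓ)
             (λ (_ , _ , eq) (_ , _ , eq′) → c .injective j (trans eq (sym eq′))) proj₁) ⟩
      count overtaken? requests
        ≤⟨ count-injective overtaken? k (rank r) requests-unique proj₂ same ⟩
      k ∎
      where
      same : ∀ {u v} → Overtaken u → Overtaken v → rank r u ≡ rank r v → u ≡ v
      same (refl , _) (refl , _) eq = cong (process e ,_) (c .injective (process e) eq)

    nearOf≤ : ∀ j → nearOf j ≤ suc k
    nearOf≤ j = count-injective (λ y → near? (j , y)) (suc k) (r j) (allFin⁺ ℓ)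
      (λ (_ , le) → s≤s le) (λ _ _ → c .injective j)

    -- Consistency makes the ranks strictly less than `k`, hence one fewer than in `nearOf≤`.
    nearOf-own : nearOf (process e) ≤ k
    nearOf-own = count-injective (λ y → near? (process e , y)) k (r (process e)) (allFin⁺ ℓ)
      (λ (t , _) → c .ordered refl t) (λ _ _ → c .injective (process e))

    -- Every process has a share of `2 * suc k`. The requesting one has no fresh pairs and uses at
    -- most `k` of its share; the `k + 2` left over is what `amortized` needs beyond `n`.
    fresh+near : ∑ requests (λ u → count (fresh? u) requests) + count near? requests + (k + 2) ≤
                 2 * p * suc k
    fresh+near = begin
      ∑ requests (λ u → count (fresh? u) requests) + count near? requests + (k + 2)
        ≡⟨ cong (_+ (k + 2)) (cong₂ _+_ (∑-product (allFin p) (allFin ℓ) _)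
                                       (∑-product (allFin p) (allFin ℓ) _)) ⟩
      ∑ (allFin p) freshOf + ∑ (allFin p) nearOf + (k + 2)
        ≡⟨ cong (_+ (k + 2)) (∑-+ (allFin p) freshOf nearOf) ⟨
      ∑ (allFin p) (λ j → freshOf j + nearOf j) + (k + 2)
        ≤⟨ ∑-mono-at (k + 2) 0 (∈-allFin (process e)) other own ⟩
      ∑ (allFin p) (λ _ → 2 * suc k) + 0
        ≡⟨ cong (_+ 0) (∑-const (allFin p) (2 * suc k)) ⟩
      length (allFin p) * (2 * suc k) + 0
        ≡⟨ cong (λ n → n * (2 * suc k) + 0) (length-tabulate {n = p} (λ i → i)) ⟩
      p * (2 * suc k) + 0
        ≡⟨ regroup p (suc k) ⟩
      2 * p * suc k ∎
      where
      regroup : ∀ p m → p * (2 * m) + 0 ≡ 2 * p * m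
      regroup = solve-∀
      other : ∀ j → freshOf j + nearOf j ≤ 2 * suc k
      other j = begin
        freshOf j + nearOf j ≤⟨ +-mono-≤ (≤-trans (freshOf≤ j) (n≤1+n k)) (nearOf≤ j) ⟩
        suc k + suc k        ≡⟨ cong (suc k +_) (+-identityʳ (suc k)) ⟨
        2 * suc k            ∎
      own : freshOf (process e) + nearOf (process e) + (k + 2) ≤ 2 * suc k + 0
      own = begin
        freshOf (process e) + nearOf (process e) + (k + 2)
          ≤⟨ +-monoˡ-≤ (k + 2) (+-mono-≤ freshOf-own nearOf-own) ⟩
        k + (k + 2)    ≡⟨ twice k ⟩
        2 * suc k + 0  ∎
        where
        twice : ∀ k → k + (k + 2) ≡ 2 * (1 + k) + 0
        twice = solve-∀

    -- Here `suc n` will be the cost of the request in DMTF. The summand `suc k` on the left turns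
    -- the factor `2 * p` into `2 * p - 1` without subtraction.
    amortized : ∀ {n} → n ≤ count ahead? requests →
                suc n + suc k + discord r′ b′ ≤ 2 * p * suc k + discord r b
    amortized {n} n≤ = begin
      suc n + suc k + discord r′ b′
        ≡⟨ regroup₁ n k (discord r′ b′) ⟩
      discord r′ b′ + n + (k + 2)
        ≤⟨ +-monoˡ-≤ (k + 2) (≤-trans (+-monoʳ-≤ (discord r′ b′) n≤) discord-step) ⟩
      discord r b + (∑ requests (λ u → count (fresh? u) requests) + count near? requests) + (k + 2)
        ≡⟨ +-assoc (discord r b) _ (k + 2) ⟩
      discord r b + (∑ requests (λ u → count (fresh? u) requests) + count near? requests + (k + 2))
        ≤⟨ +-monoʳ-≤ (discord r b) fresh+near ⟩
      discord r b + 2 * p * suc k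
        ≡⟨ +-comm (discord r b) _ ⟩
      2 * p * suc k + discord r b ∎
      where
      regroup₁ : ∀ n k d → suc n + suc k + d ≡ d + n + (k + 2)
      regroup₁ = solve-∀

-- Executions of DMTF

module _ {p ℓ : ℕ} where

  Exposed : Order {p} {ℓ} → Item ℓ → Request p ℓ → Set
  Exposed b y e = ∃[ j ] T (b (j , y) e)

  -- How the merged list determines the list of DMTF: the first of the copies
  -- of an item gives its place.
  Refines : Order {p} {ℓ} → Item ℓ → Item ℓ → Set
  Refines b y x = ∀ i → Exposed b y (i , x)

  exposed-keep : ∀ b e {e′ y} → e′ ≢ e → Exposed b y e′ → Exposed (bring e b) y e′
  exposed-keep b e e′≢e (j , t) = j , bring-keep e b e′≢e t

  refines-keep : ∀ b i {a L} → All (a ≢_) L → AllPairs (Refines b) L →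
                 AllPairs (Refines (bring (i , a) b)) L
  refines-keep b i {a} = AllPairs-mapAll λ {x} {y} _ a≢y ref k →
    exposed-keep b (i , a) {k , y} {x} (a≢y ∘ sym ∘ cong proj₂) (ref k)

  refines-front : ∀ b i {a L} → All (a ≢_) L → All (Refines (bring (i , a) b) a) L
  refines-front b i {a} = All.map λ {x} a≢x k →
    i , bring-source (i , a) b {k , x} (a≢x ∘ sym ∘ cong proj₂)

  -- Each item of `xs` supplies a copy in front of `e`; as `xs` is part of a permutation of all
  -- items, no copy is counted twice.
  length≤ahead : ∀ (b : Order {p} {ℓ}) e xs {zs} → xs ++ zs ↭ allFin ℓ →
                 All (λ y → Exposed b y e) xs →
                 length xs ≤ count (λ v → T? (b v e)) requests
  length≤ahead b e xs {zs} π exposed = begin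
    length xs                          ≡⟨ *-identityʳ _ ⟨
    length xs * 1                      ≡⟨ ∑-const xs 1 ⟨
    ∑ xs (λ _ → 1)                     ≤⟨ ∑-monoAll (All.map (λ {y} → some {y}) exposed) ⟩
    ∑ xs copies                        ≤⟨ m≤m+n (∑ xs copies) _ ⟩
    ∑ xs copies + ∑ zs copies          ≡⟨ ∑-++ xs zs copies ⟨
    ∑ (xs ++ zs) copies                ≡⟨ ∑-↭ copies π ⟩
    ∑ (allFin ℓ) copies
      ≡⟨ ∑-swap (allFin ℓ) (allFin p) (λ y j → 𝟙 (T? (b (j , y) e))) ⟩
    ∑ (allFin p) (λ j → ∑ (allFin ℓ) (λ y → 𝟙 (T? (b (j , y) e))))
      ≡⟨ ∑-product (allFin p) (allFin ℓ) (λ v → 𝟙 (T? (b v e))) ⟨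
    count (λ v → T? (b v e)) requests  ∎
    where
    copies : Item ℓ → ℕ
    copies y = ∑ (allFin p) (λ j → 𝟙 (T? (b (j , y) e)))
    some : ∀ {y} → Exposed b y e → 1 ≤ copies y
    some {y} (j , t) =
      ≤-trans (𝟙-yes (T? (b (j , y) e)) t) (∈⇒≤∑ (λ j → 𝟙 (T? (b (j , y) e))) (∈-allFin j))

  -- The invariant of the induction on executions: `c` is the remaining cost of DMTF and `discord`
  -- the potential of the current state.
  Bounded : ℕ → ProcessRanks {p} {ℓ} → Order {p} {ℓ} → List (Request p ℓ) → Set
  Bounded c r b M = c + costMTFs r M ≤ 2 * p * costMTFs r M + discord r b

  bounded-∷ : ∀ {c r b} e {M} xs {zs} → Consistent r b → xs ++ zs ↭ allFin ℓ →
              All (λ y → Exposed b y e) xs →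
              Bounded c (advance e r) (bring e b) M →
              Bounded (suc (length xs) + c) r b (e ∷ M)
  bounded-∷ {c} {r} {b} e {M} xs con π exposed le = begin
    suc (length xs) + c + (suc k + C)
      ≡⟨ regroup₁ (suc (length xs)) c (suc k) C ⟩
    suc (length xs) + suc k + (c + C)
      ≤⟨ +-monoʳ-≤ (suc (length xs) + suc k) le ⟩
    suc (length xs) + suc k + (2 * p * C + D)
      ≡⟨ regroup₂ (suc (length xs) + suc k) (2 * p * C) D ⟩
    suc (length xs) + suc k + D + 2 * p * C
      ≤⟨ +-monoˡ-≤ (2 * p * C) (Step.amortized con e (length≤ahead b e xs π exposed)) ⟩
    2 * p * suc k + discord r b + 2 * p * C
      ≡⟨ regroup₃ (2 * p) (suc k) C (discord r b) ⟩
    2 * p * (suc k + C) + discord r b ∎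
    where
    k C D : ℕ
    k = rank r e
    C = costMTFs (advance e r) M
    D = discord (advance e r) (bring e b)
    regroup₁ : ∀ n c k C → n + c + (k + C) ≡ n + k + (c + C)
    regroup₁ = solve-∀
    regroup₂ : ∀ n q d → n + (q + d) ≡ n + d + q
    regroup₂ = solve-∀
    regroup₃ : ∀ q k C d → q * k + d + q * C ≡ q * (k + C) + d
    regroup₃ = solve-∀

  -- The list of DMTF is fixed during the group, while the merged order changes after each request.
  -- As the processes are distinct, bringing `(i , a)` forward keeps everything in front of the
  -- later copies `(j , a)`, so each of them still sees all of `xs` exposed. `rest` quantifies over
  -- the state reached after the last request.
  bounded-group : ∀ {c r b M a} xs {ys} → xs ++ a ∷ ys ↭ allFin ℓ → All (a ≢_) (xs ++ ys) →
    ∀ i is → Unique (i ∷ is) → Consistent r b →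
    All (λ j → All (λ y → Exposed b y (j , a)) xs) (i ∷ is) →
    AllPairs (Refines b) (xs ++ ys) →
    (∀ {r b} → Consistent r b → AllPairs (Refines b) (a ∷ xs ++ ys) → Bounded c r b M) →
    Bounded (length (i ∷ is) * suc (length xs) + c) r b (map (_, a) (i ∷ is) ++ M)
  bounded-group {c} {r} {b} {M} {a} xs {ys} π a≢ i is (i≢ ∷ u) con (ex ∷ exs) ref rest =
    subst (λ n → Bounded n r b (map (_, a) (i ∷ is) ++ M)) (sym (+-assoc (suc (length xs)) _ c))
      (bounded-∷ (i , a) {map (_, a) is ++ M} xs con π ex (others is i≢ u exs))
    where
    con′ : Consistent (advance (i , a) r) (bring (i , a) b)
    con′ = consistent-step (i , a) con
    ref′ : AllPairs (Refines (bring (i , a) b)) (xs ++ ys)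
    ref′ = refines-keep b i a≢ ref
    keep : ∀ {j} → i ≢ j × All (λ y → Exposed b y (j , a)) xs →
           All (λ y → Exposed (bring (i , a) b) y (j , a)) xs
    keep {j} (i≢j , ex) =
      All.map (λ {y} → exposed-keep b (i , a) {j , a} {y} (i≢j ∘ sym ∘ cong proj₁)) ex
    others : ∀ is → All (i ≢_) is → Unique is → All (λ j → All (λ y → Exposed b y (j , a)) xs) is →
             Bounded (length is * suc (length xs) + c) (advance (i , a) r) (bring (i , a) b)
                     (map (_, a) is ++ M)
    others []        _  _ _   = rest con′ (refines-front b i a≢ ∷ ref′)
    others (i′ ∷ is) i≢ u exs =
      bounded-group xs π a≢ i′ is u con′ (All.zipWith keep (i≢ , exs)) ref′ rest

  bounded : ∀ {L M r b} (E : DMTFExecution L M) → L ↭ allFin ℓ → Consistent r b →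
            AllPairs (Refines b) L → Bounded (costDMTF E) r b M
  bounded [] π con ref = z≤n
  bounded {b = b} (serve xs a ys i is u E) π con ref with AllPairs-remove xs ref
  ... | before , ref′ = bounded-group xs π a≢ i is u con
          -- `Refines` speaks of the copies of all processes, so the items before `a` are exposed
          -- whichever processes form the group.
          (All.universal (λ j → All.map (λ ref → ref j) before) (i ∷ is)) ref′
          (bounded E π′)
    where
    π′ : a ∷ xs ++ ys ↭ allFin ℓ
    π′ = ↭-trans (↭-sym (↭-shift a xs ys)) π
    a≢ : All (a ≢_) (xs ++ ys)
    a≢ with Unique-↭ (↭-sym π′) (allFin⁺ ℓ)
    ... | a≢ ∷ _ = a≢

-- The common initial list and the two inequalities

module _ {p ℓ : ℕ} (L : ListOrder ℓ) where

  private
    r₀ : Ranks {ℓ}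
    r₀ = index (items L)

    distinct : Unique (items L)
    distinct = Unique-↭ (↭-sym (arranges L)) (allFin⁺ ℓ)

    injective₀ : Injective r₀
    injective₀ = index-injective (items L) (∈-resp-↭ (↭-sym (arranges L)) (∈-allFin _))

    dense₀ : Dense r₀
    dense₀ x = ≤-trans (index-dense (items L) x) (≤-reflexive (∑-↭ _ (arranges L)))

    -- Copies of one item are left incomparable. Since all processes start from the same list, no
    -- pair is discordant and the potential starts at 0.
    b₀ : Order {p} {ℓ}
    b₀ u v = r₀ (item u) ℕ.<ᵇ r₀ (item v)

    consistent₀ : Consistent (λ _ → r₀) b₀
    consistent₀ = record
      { injective = λ _ → injective₀
      ; ordered   = λ {u} {v} _ t → <ᵇ⇒< (r₀ (item u)) (r₀ (item v)) t
      }

    refines₀ : AllPairs (Refines b₀) (items L)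
    refines₀ = AllPairs-mapAll {F = λ _ → ⊤} (λ _ _ lt i → i , <⇒<ᵇ lt)
                 (All.universal (λ _ → tt) _) (index-increasing distinct)

    discord₀ : discord (λ _ → r₀) b₀ ≤ 0
    discord₀ = ∑-zero requests λ u → ∑-zero requests λ v →
      𝟙-no (discordant? (λ _ → r₀) b₀ u v)
           (λ (t , lt) → <-asym lt (<ᵇ⇒< (r₀ (item v)) (r₀ (item u)) t))

  costDMTF≤costMTFs : ∀ {M} (E : DMTFExecution (items L) M) →
    costDMTF E + costMTFs (λ _ → r₀) M ≤ 2 * p * costMTFs (λ _ → r₀) M
  costDMTF≤costMTFs {M} E = begin
    costDMTF E + C                         ≤⟨ bounded E (arranges L) consistent₀ refines₀ ⟩
    2 * p * C + discord (λ _ → r₀) b₀      ≤⟨ +-monoʳ-≤ (2 * p * C) discord₀ ⟩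
    2 * p * C + 0                          ≡⟨ +-identityʳ _ ⟩
    2 * p * C                              ∎
    where
    C : ℕ
    C = costMTFs (λ _ → r₀) M

  costMTFs≤2pCost : ∀ {σ : Fin p → List (Item ℓ)} M₁ M₂ → IsMerge σ M₁ → IsMerge σ M₂ →
    (S : Schedule (items L) (map item M₂)) →
    costMTFs (λ _ → r₀) M₁ ≤ 2 * p * cost S
  costMTFs≤2pCost M₁ M₂ m₁ m₂ S = begin
    costMTFs (λ _ → r₀) M₁
      ≤⟨ costMTFs≤∑costMTF (λ _ → r₀) M₁ ⟩
    ∑ (allFin p) (λ j → costMTF r₀ (requestsBy j M₁))
      ≤⟨ ∑-mono (allFin p) each ⟩
    ∑ (allFin p) (λ _ → 2 * cost S)
      ≡⟨ ∑-const (allFin p) (2 * cost S) ⟩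
    length (allFin p) * (2 * cost S)
      ≡⟨ cong (_* (2 * cost S)) (length-tabulate {n = p} (λ i → i)) ⟩
    p * (2 * cost S)
      ≡⟨ regroup p (cost S) ⟩
    2 * p * cost S ∎
    where
    regroup : ∀ p m → p * (2 * m) ≡ 2 * p * m
    regroup = solve-∀
    each : ∀ j → costMTF r₀ (requestsBy j M₁) ≤ 2 * cost S
    each j = begin
      -- The two merges meet here: process `j` issues the same requests in both.
      costMTF r₀ (requestsBy j M₁)         ≡⟨ cong (costMTF r₀) (trans (m₁ j) (sym (m₂ j))) ⟩
      costMTF r₀ (requestsBy j M₂)         ≤⟨ costMTF≤2cost j S M₂ refl (arranges L) r₀ injective₀ dense₀ ⟩
      2 * cost S + inversions r₀ (items L)
        ≤⟨ +-monoʳ-≤ (2 * cost S) (inversions-increasing r₀ (index-increasing distinct)) ⟩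
      2 * cost S + 0                       ≡⟨ +-identityʳ _ ⟩
      2 * cost S                           ∎

theorem16 : ∀ (p ℓ : ℕ) → p ≥ 1 → ℓ ≥ 1 →
    ∃[ α ]
    (∀ (L₀ : ListOrder ℓ) (σ : Fin p → List (Item ℓ))
    (M₁ M₂ : List (Request p ℓ)) →
    IsMerge σ M₁ → IsMerge σ M₂ →
    (E : DMTFExecution (items L₀) M₁) →
    costDMTF E ≤ (4 * p ^ 2 ∸ 2 * p) * OPT L₀ (map item M₂) + α)
-- No additive constant arises, because both potentials vanish while all lists are equal.
theorem16 p ℓ p≥1 ℓ≥1 = 0 , bound
  where
  factor : 4 * p ^ 2 ∸ 2 * p ≡ (2 * p ∸ 1) * (2 * p)
  factor = trans (cong₂ _∸_ (square p) (sym (*-identityˡ (2 * p))))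
                 (sym (*-distribʳ-∸ (2 * p) (2 * p) 1))
    where
    square : ∀ p → 4 * (p * (p * 1)) ≡ 2 * p * (2 * p)
    square = solve-∀
  bound : ∀ L₀ σ M₁ M₂ → IsMerge σ M₁ → IsMerge σ M₂ → (E : DMTFExecution (items L₀) M₁) →
          costDMTF E ≤ (4 * p ^ 2 ∸ 2 * p) * OPT L₀ (map item M₂) + 0
  bound L₀ σ M₁ M₂ m₁ m₂ E = begin
    -- The separate cost `C` moves to the right by truncated subtraction, which gives the factor
    -- `2 * p ∸ 1`.
    costDMTF E                          ≤⟨ m+n≤o⇒m≤o∸n (costDMTF E) (costDMTF≤costMTFs L₀ E) ⟩
    2 * p * C ∸ C                       ≡⟨ cong (2 * p * C ∸_) (*-identityˡ C) ⟨
    2 * p * C ∸ 1 * C                   ≡⟨ *-distribʳ-∸ C (2 * p) 1 ⟨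
    (2 * p ∸ 1) * C                     ≤⟨ *-monoʳ-≤ (2 * p ∸ 1) 
        (costMTFs≤2pCost L₀ M₁ M₂ m₁ m₂ (proj₁ (optimalSchedule L₀ (map item M₂)))) ⟩
    (2 * p ∸ 1) * (2 * p * O)           ≡⟨ *-assoc (2 * p ∸ 1) (2 * p) O ⟨
    (2 * p ∸ 1) * (2 * p) * O           ≡⟨ cong (_* O) factor ⟨
    (4 * p ^ 2 ∸ 2 * p) * O             ≡⟨ +-identityʳ _ ⟨
    (4 * p ^ 2 ∸ 2 * p) * O + 0         ∎
    where
    O C : ℕ
    O = OPT L₀ (map item M₂)
    C = costMTFs (λ _ → index (items L₀)) M₁
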